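{- Let $\sigma$ and $\tau$ be possibly empty connected non-crossing partitions. Then $1[\sigma]1[\tau]$ and $1[\tau]1[\sigma]$ are nc-equivalent, i.e. for every $n\ge0$ the number of partitions of $[n]$ avoiding both $1212$ and $1[\sigma]1[\tau]$ equals the number avoiding both $1212$ and $1[\tau]1[\sigma]$.
   Context: Set partitions are written in canonical sequential form (restricted growth words). Pattern containment means having a subsequence order-isomorphic to the pattern; a partition is non-crossing if it avoids $1212$. Bracket notation: in a word built from letters and bracketed partitions, $[\sigma]$ stands for $\sigma+r$ (add $r$ to every letter), where $r$ is the number of distinct symbols appearing before it (e.g. $1[12]1[1]=12314$; for empty $\sigma$, $1[\sigma]1[\tau]=11[\tau]$). $\alpha[\beta]$ is $\alpha$ followed by $\beta$ shifted by the number of blocks of $\alpha$; a partition is connected if it cannot be written as $\alpha[\beta]$ with $\alpha,\beta$ nonempty. -}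

module Defs where

open import Data.Nat using (ℕ; zero; suc; _+_; _≤_; _<_; _⊔_; z≤n; s≤s; _<?_; _≟_)
open import Data.Nat.Properties using (suc-injective)
open import Data.Fin using (Fin; cast)
open import Data.Fin.Properties using (all?)
open import Data.List
  using (List; []; _∷_; _++_; map; concatMap; deduplicate; filter; foldl; length; lookup; upTo)
open import Data.List.Properties using (∷-injectiveˡ; ∷-injectiveʳ)
open import Data.List.Membership.Propositional using (_∈_; find; lose)
open import Data.List.Membership.Propositional.Properties
  using (∈-map⁺; ∈-map⁻; ∈-concatMap⁺; ∈-concatMap⁻; ∈-upTo⁺; ∈-upTo⁻)
open import Data.List.Relation.Binary.Sublist.Propositional using (_⊆_; []; _∷_; _∷ʳ_)
import Data.List.Relation.Unary.All as All
import Data.List.Relation.Unary.All.Properties as All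
open import Data.List.Relation.Unary.Any using (here)
import Data.List.Relation.Unary.AllPairs as AllPairs
import Data.List.Relation.Unary.AllPairs.Properties as AllPairs
open import Data.List.Relation.Unary.Unique.Propositional using (Unique; []; _∷_)
import Data.List.Relation.Unary.Unique.Propositional.Properties as Unique
open import Data.Product using (∃; ∃-syntax; _×_; _,_; proj₁; proj₂)
open import Data.Sum using (_⊎_; inj₁; inj₂)
open import Function using (_∘_; _⇔_; mk⇔; Equivalence)
open import Level using (Level)
open import Relation.Binary.PropositionalEquality using (_≡_; _≢_; refl; cong)
open import Relation.Nullary using (Dec; yes; no; ¬_)
open import Relation.Nullary.Decidable using (map′; ¬?; _×-dec_; _→-dec_; _⊎-dec_)
open import Relation.Unary using (Decidable)

private
  variable
    ℓ : Level

Word : Set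
Word = List ℕ

-- GrowsFrom m w: w continues a restricted growth word with largest letter m,
-- so each letter is positive and exceeds the maximum of all preceding letters
-- by at most one.
data GrowsFrom (m : ℕ) : Word → Set where
  []  : GrowsFrom m []
  _∷_ : ∀ {a w} → 1 ≤ a × a ≤ suc m → GrowsFrom (m ⊔ a) w → GrowsFrom m (a ∷ w)

-- A partition of {1,…,n} is its canonical sequence π₁…πₙ, where πᵢ is the index
-- of the block of i and blocks are numbered 1,2,… by increasing minimum.
IsPartition : Word → Set
IsPartition = GrowsFrom 0

blocks : Word → ℕ
blocks w = length (deduplicate _≟_ w)

OrderIsomorphic : Word → Word → Set
OrderIsomorphic u v =
  ∃ λ (eq : length u ≡ length v) → ∀ (i j : Fin (length u)) →
    (lookup u i < lookup u j) ⇔ (lookup v (cast eq i) < lookup v (cast eq j))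

Contains : Word → Word → Set
Contains w p = ∃ λ u → u ⊆ w × OrderIsomorphic u p

Avoids : Word → Word → Set
Avoids w p = ¬ Contains w p

⟨1212⟩ : Word
⟨1212⟩ = 1 ∷ 2 ∷ 1 ∷ 2 ∷ []

NonCrossing : Word → Set
NonCrossing w = Avoids w ⟨1212⟩

shift : ℕ → Word → Word
shift r = map (_+ r)

data Item : Set where
  letter : ℕ → Item
  [_]    : Word → Item

append : Word → Item → Word
append w (letter a) = w ++ a ∷ []
append w [ σ ]      = w ++ shift (blocks w) σ

⟦_⟧ : List Item → Word
⟦_⟧ = foldl append []

_ : ⟦ letter 1 ∷ [ 1 ∷ 2 ∷ [] ] ∷ letter 1 ∷ [ 1 ∷ [] ] ∷ [] ⟧ ≡ 1 ∷ 2 ∷ 3 ∷ 1 ∷ 4 ∷ []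
_ = refl

1[_]1[_] : Word → Word → Word
1[ σ ]1[ τ ] = ⟦ letter 1 ∷ [ σ ] ∷ letter 1 ∷ [ τ ] ∷ [] ⟧

-- Usually written α[β]; equal to ⟦ [ α ] ∷ [ β ] ∷ [] ⟧ since the first shift is by 0.
_⟨_⟩ : Word → Word → Word
α ⟨ β ⟩ = α ++ shift (blocks α) β

Connected : Word → Set
Connected π =
  ¬ (∃[ α ] ∃[ β ] IsPartition α × IsPartition β × α ≢ [] × β ≢ [] × π ≡ α ⟨ β ⟩)

orderIsomorphic? : ∀ u v → Dec (OrderIsomorphic u v)
orderIsomorphic? u v with length u ≟ length v
... | no ≢    = no (≢ ∘ proj₁)
... | yes eq = map′ (eq ,_) (λ { (_ , f) → f }) (all? λ i → all? λ j →
        (lookup u i <? lookup u j) ⇔-dec (lookup v (cast eq i) <? lookup v (cast eq j)))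
  where
  _⇔-dec_ : ∀ {A B : Set} → Dec A → Dec B → Dec (A ⇔ B)
  a ⇔-dec b = map′ (λ (f , g) → mk⇔ f g) (λ e → Equivalence.to e , Equivalence.from e)
                   ((a →-dec b) ×-dec (b →-dec a))

∃⊆? : {P : Word → Set ℓ} → Decidable P → ∀ w → Dec (∃ λ u → u ⊆ w × P u)
∃⊆? P? []      = map′ (λ p → [] , [] , p) (λ { ([] , [] , p) → p }) (P? [])
∃⊆? {P = P} P? (x ∷ w) = map′ to from (∃⊆? (P? ∘ (x ∷_)) w ⊎-dec ∃⊆? P? w)
  where
  to : (∃ λ u → u ⊆ w × P (x ∷ u)) ⊎ (∃ λ u → u ⊆ w × P u) → ∃ λ u → u ⊆ x ∷ w × P u
  to (inj₁ (u , s , p)) = x ∷ u , refl ∷ s , p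
  to (inj₂ (u , s , p)) = u , x ∷ʳ s , p
  from : (∃ λ u → u ⊆ x ∷ w × P u) → (∃ λ u → u ⊆ w × P (x ∷ u)) ⊎ (∃ λ u → u ⊆ w × P u)
  from (_ , refl ∷ s , p) = inj₁ (_ , s , p)
  from (_ , _ ∷ʳ s , p)   = inj₂ (_ , s , p)

avoids? : ∀ w p → Dec (Avoids w p)
avoids? w p = ¬? (∃⊆? (λ u → orderIsomorphic? u p) w)

growths : ℕ → ℕ → List Word
growths m zero    = [] ∷ []
growths m (suc n) = concatMap (λ k → map (suc k ∷_) (growths (m ⊔ suc k) n)) (upTo (suc m))

partitions : ℕ → List Word
partitions = growths 0

nc : ℕ → Word → ℕ
nc n p = length (filter (λ w → avoids? w ⟨1212⟩ ×-dec avoids? w p) (partitions n))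

NCEquivalent : Word → Word → Set
NCEquivalent p q = ∀ n → nc n p ≡ nc n q

-- The enumeration used for counting lists each partition of [n] exactly once.

growths-complete : ∀ {m} w → GrowsFrom m w → w ∈ growths m (length w)
growths-complete []            []                        = here refl
growths-complete (suc k ∷ w) ((_ , s≤s k≤m) ∷ g) =
  ∈-concatMap⁺ _ (lose (∈-upTo⁺ (s≤s k≤m)) (∈-map⁺ (suc k ∷_) (growths-complete w g)))

growths-sound : ∀ m n {w} → w ∈ growths m n → GrowsFrom m w × length w ≡ n
growths-sound m zero    (here refl) = [] , refl
growths-sound m (suc n) w∈ with find (∈-concatMap⁻ _ {xs = upTo (suc m)} w∈)
... | k , k∈ , w∈′ with ∈-map⁻ (suc k ∷_) w∈′
... | u , u∈ , refl with growths-sound (m ⊔ suc k) n u∈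
... | g , eq = (s≤s z≤n , ∈-upTo⁻ k∈) ∷ g , cong suc eq

growths-unique : ∀ m n → Unique (growths m n)
growths-unique m zero    = All.[] ∷ []
growths-unique m (suc n) = Unique.concat⁺
  (All.map⁺ (All.tabulate λ {k} _ →
    Unique.map⁺ ∷-injectiveʳ (growths-unique (m ⊔ suc k) n)))
  (AllPairs.map⁺ (AllPairs.map disjoint (Unique.upTo⁺ (suc m))))
  where
  disjoint : ∀ {k l} {us vs : List Word} → k ≢ l →
             ∀ {w} → ¬ (w ∈ map (suc k ∷_) us × w ∈ map (suc l ∷_) vs)
  disjoint k≢l (p , q) with ∈-map⁻ _ p | ∈-map⁻ _ q
  ... | _ , _ , refl | _ , _ , eq = k≢l (suc-injective (∷-injectiveˡ eq))

∈-partitions : ∀ n w → w ∈ partitions n ⇔ (IsPartition w × length w ≡ n)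
∈-partitions n w = mk⇔ (growths-sound 0 n) λ { (g , refl) → growths-complete w g }

partitions-unique : ∀ n → Unique (partitions n)
partitions-unique = growths-unique 0

{-# OPTIONS --safe #-}
module Submission where

-- A non-crossing partition is uniquely 1[w₁]1[w₂]…1[wₖ] with non-crossing wᵢ, so it is a
-- plane tree. Since σ and τ are connected, it avoids 1[σ]1[τ] iff every wᵢ does and there
-- are no i < j with σ in wᵢ and τ in wⱼ. Hence reversing the order of the wᵢ, recursively,
-- would exchange the two patterns if the recursion preserved containment of σ and of τ.
-- To make it do so, reverse only where some wᵢ contains σ and some wⱼ contains τ: there σ and
-- τ are contained before and after, and elsewhere neither 1[σ]1[τ] nor 1[τ]1[σ] is contained
-- at all. The result is a length-preserving involution.

open import Defs
open import Data.Empty using (⊥)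
open import Data.Fin using (Fin; cast; toℕ)
open import Data.Fin.Properties using (toℕ-cast; toℕ-injective; any?)
open import Data.List
  using (List; []; _∷_; _++_; map; foldl; length; lookup; upTo; deduplicate; filter; reverse; drop)
open import Data.List.Properties
  using ( ++-assoc; ++-cancelˡ; ++-identityʳ; ∷-injective; length-++; length-++-sucʳ; length-++-≤ˡ; length-++-≤ʳ
        ; length-map; length-upTo; map-++; map-∘; map-cong; map-cong-local; map-id; map-id-local
        ; reverse-involutive; reverse-map; unfold-reverse)
open import Data.List.Membership.Propositional using (_∈_)
open import Data.List.Membership.Propositional.Properties
  using ( ∈-++⁺ˡ; ∈-++⁺ʳ; ∈-++⁻; ∈-∃++; ∈-deduplicate⁺; ∈-deduplicate⁻; ∈-filter⁺; ∈-filter⁻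
        ; ∈-lookup; ∈-map⁺; ∈-map⁻; ∈-upTo⁺; ∈-upTo⁻)
open import Data.List.Relation.Binary.Permutation.Propositional using (↭-sym)
open import Data.List.Relation.Binary.Permutation.Propositional.Properties as ↭ using (↭-reverse)
open import Data.List.Relation.Binary.Pointwise using (lookup⁻; Pointwise-≡⇒≡)
open import Data.List.Relation.Binary.Sublist.Propositional as Sublist
  using (_⊆_; []; _∷_; _∷ʳ_; ⊆-trans; ⊆-refl; minimum)
open import Data.List.Relation.Binary.Sublist.Propositional.Properties
  using (map⁺; All-resp-⊆; ++⁺; ++⁺ˡ; ++⁺ʳ; ∷ˡ⁻)
open import Data.List.Relation.Unary.All as All using (All; []; _∷_)
import Data.List.Relation.Unary.All.Properties as All
open import Data.List.Relation.Unary.AllPairs as AllPairs using (AllPairs; []; _∷_)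
import Data.List.Relation.Unary.AllPairs.Properties as AllPairs
open import Data.List.Relation.Unary.Any as Any using (Any; here; there)
import Data.List.Relation.Unary.Any.Properties as Any
open import Data.List.Relation.Unary.Unique.Propositional using (Unique)
import Data.List.Relation.Unary.Unique.Propositional.Properties as Unique
open import Data.Nat using (ℕ; suc; _+_; _∸_; _≤_; _<_; _⊔_; z≤n; s≤s; _≟_; _≤?_)
open import Data.Nat.ListAction using (sum)
open import Data.Nat.ListAction.Properties using (sum-↭)
open import Data.Nat.Properties
open import Data.List.Relation.Unary.Unique.DecPropositional.Properties _≟_ using (deduplicate-!)
open import Data.Product using (∃; _×_; _,_; proj₁; proj₂)
open import Data.Sum using (_⊎_; inj₁; inj₂; [_,_]′)
open import Function using (_∘_; flip; mk⇔; Equivalence)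
open import Relation.Binary.Definitions using (tri<; tri≈; tri>)
open import Relation.Binary.PropositionalEquality
  using (_≡_; _≢_; refl; sym; trans; cong; cong₂; subst; subst₂; module ≡-Reasoning)
open import Relation.Nullary using (Dec; yes; no; ¬_; contradiction)
open import Relation.Nullary.Decidable using (_×-dec_)

-- Counting

∈-remove : ∀ {A : Set} {x y : A} us {vs} → x ∈ us ++ y ∷ vs → x ≢ y → x ∈ us ++ vs
∈-remove us x∈ x≢y with ∈-++⁻ us x∈
... | inj₁ x∈us          = ∈-++⁺ˡ x∈us
... | inj₂ (here x≡y)    = contradiction x≡y x≢y
... | inj₂ (there x∈vs)  = ∈-++⁺ʳ us x∈vs

-- The injection is a relation because the map used for counting goes through a decoded tree, which
-- is only known to exist. By injectivity no later element shares the partner of the head, so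
-- deleting that partner from `ys` leaves all later partners in place.
injection⇒length≤ : ∀ {A B : Set} (R : A → B → Set) → (∀ {x x′ y} → R x y → R x′ y → x ≡ x′) →
  ∀ {xs} → Unique xs → ∀ ys → (∀ {x} → x ∈ xs → ∃ λ y → y ∈ ys × R x y) → length xs ≤ length ys
injection⇒length≤ R inj []               ys tot = z≤n
injection⇒length≤ R inj (x∉ ∷ xs!) ys tot with tot (here refl)
... | y , y∈ , rxy with ∈-∃++ y∈
... | us , vs , refl = subst (_ ≤_) (sym (length-++-sucʳ us _ vs)) (s≤s (injection⇒length≤ R inj xs! (us ++ vs) tot′))
  where
  tot′ : ∀ {x} → x ∈ _ → ∃ λ y → y ∈ us ++ vs × R x y
  tot′ x∈ with tot (there x∈)
  ... | y′ , y′∈ , r = y′ , ∈-remove us y′∈ (λ { refl → All.lookup x∉ x∈ (inj rxy r) }) , r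

unique-⊆⇒length≤ : ∀ {A : Set} {xs ys : List A} → Unique xs → (∀ {x} → x ∈ xs → x ∈ ys) → length xs ≤ length ys
unique-⊆⇒length≤ xs! sub = injection⇒length≤ _≡_ (λ { refl refl → refl }) xs! _ λ x∈ → _ , sub x∈ , refl

-- Restricted growth words

peak : ℕ → Word → ℕ
peak = foldl _⊔_

≤-peak : ∀ m w → m ≤ peak m w
≤-peak m []      = ≤-refl
≤-peak m (a ∷ w) = ≤-trans (m≤m⊔n m a) (≤-peak (m ⊔ a) w)

All-≤-peak : ∀ m w → All (_≤ peak m w) w
All-≤-peak m []      = []
All-≤-peak m (a ∷ w) = ≤-trans (m≤n⊔m m a) (≤-peak (m ⊔ a) w) ∷ All-≤-peak (m ⊔ a) w

peak-< : ∀ {m y} w → m < y → All (_< y) w → peak m w < y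
peak-< []      m<y []         = m<y
peak-< (a ∷ w) m<y (a<y ∷ ws) = peak-< w (⊔-lub m<y a<y) ws

GrowsFrom-++⁺ : ∀ {m u v} → GrowsFrom m u → GrowsFrom (peak m u) v → GrowsFrom m (u ++ v)
GrowsFrom-++⁺ []      h = h
GrowsFrom-++⁺ (b ∷ g) h = b ∷ GrowsFrom-++⁺ g h

GrowsFrom-++⁻ : ∀ {m} u {v} → GrowsFrom m (u ++ v) → GrowsFrom m u × GrowsFrom (peak m u) v
GrowsFrom-++⁻ []      h       = [] , h
GrowsFrom-++⁻ (_ ∷ u) (b ∷ g) = let g₁ , g₂ = GrowsFrom-++⁻ u g in b ∷ g₁ , g₂

GrowsFrom-positive : ∀ {m w} → GrowsFrom m w → All (1 ≤_) w
GrowsFrom-positive []            = []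
GrowsFrom-positive ((p , _) ∷ g) = p ∷ GrowsFrom-positive g

-- A letter exceeds the running maximum by at most one, so the maximum passes through every value up
-- to the peak, and the letter that raises it to `y` is `y` itself.
GrowsFrom-covers : ∀ {m w y} → GrowsFrom m w → m < y → y ≤ peak m w → y ∈ w
GrowsFrom-covers [] m<y y≤m = contradiction (≤-trans m<y y≤m) (<-irrefl refl)
GrowsFrom-covers {m} {a ∷ w} {y} ((_ , a≤) ∷ g) m<y y≤ with y ≤? m ⊔ a
... | no  y≰ = there (GrowsFrom-covers g (≰⇒> y≰) y≤)
... | yes y≤m⊔a with ≤-total m a
...   | inj₁ m≤a = here (≤-antisym (subst (y ≤_) (m≤n⇒m⊔n≡n m≤a) y≤m⊔a) (≤-trans a≤ m<y))
...   | inj₂ a≤m = contradiction (≤-trans m<y (subst (y ≤_) (m≥n⇒m⊔n≡m a≤m) y≤m⊔a)) (<-irrefl refl)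

-- The distinct letters are exactly 1 up to the peak: positivity and maximality give one inclusion,
-- `GrowsFrom-covers` the other. This turns the shifts of the bracket notation into running maxima.
blocks≡peak : ∀ {w} → IsPartition w → blocks w ≡ peak 0 w
blocks≡peak {w} g = ≤-antisym
  (subst (blocks w ≤_) len (unique-⊆⇒length≤ (deduplicate-! w) to))
  (subst (_≤ blocks w) len (unique-⊆⇒length≤ (Unique.map⁺ suc-injective (Unique.upTo⁺ _)) from))
  where
  len : length (map suc (upTo (peak 0 w))) ≡ peak 0 w
  len = trans (length-map suc (upTo (peak 0 w))) (length-upTo (peak 0 w))
  to : ∀ {x} → x ∈ deduplicate _≟_ w → x ∈ map suc (upTo (peak 0 w))
  to x∈ with ∈-deduplicate⁻ _≟_ w x∈
  ... | x∈w with All.lookup (GrowsFrom-positive g) x∈w | All.lookup (All-≤-peak 0 w) x∈w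
  ... | s≤s _ | x≤ = ∈-map⁺ suc (∈-upTo⁺ x≤)
  from : ∀ {x} → x ∈ map suc (upTo (peak 0 w)) → x ∈ deduplicate _≟_ w
  from x∈ with ∈-map⁻ suc x∈
  ... | k , k∈ , refl = ∈-deduplicate⁺ _≟_ (GrowsFrom-covers g (s≤s z≤n) (∈-upTo⁻ k∈))

peak-shift : ∀ k m w → peak (m + k) (shift k w) ≡ peak m w + k
peak-shift k m []      = refl
peak-shift k m (a ∷ w) = trans (cong (λ n → peak n (shift k w)) (sym (+-distribʳ-⊔ k m a))) (peak-shift k (m ⊔ a) w)

GrowsFrom-shift : ∀ {k m w} → GrowsFrom m w → GrowsFrom (m + k) (shift k w)
GrowsFrom-shift [] = []
GrowsFrom-shift {k} {m} {a ∷ w} ((p , q) ∷ g) =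
  (≤-trans p (m≤m+n a k) , +-monoˡ-≤ k q) ∷ subst (λ n → GrowsFrom n _) (+-distribʳ-⊔ k m a) (GrowsFrom-shift g)

GrowsFrom-unshift : ∀ {k w} m → GrowsFrom (m + k) w → All (k <_) w → ∃ λ v → GrowsFrom m v × w ≡ shift k v
GrowsFrom-unshift m [] [] = [] , [] , refl
GrowsFrom-unshift {k} {a ∷ w} m ((_ , a≤) ∷ g) (k<a ∷ k<) = a ∸ k ∷ v , (m<n⇒0<n∸m k<a , ∸k≤) ∷ gv , cong₂ _∷_ (sym a≡) eq
  where
  -- Truncated subtraction is exact here because every letter exceeds `k`.
  a≡ : a ∸ k + k ≡ a
  a≡ = m∸n+n≡m (<⇒≤ k<a)
  ∸k≤ : a ∸ k ≤ suc m
  ∸k≤ = +-cancelʳ-≤ k (a ∸ k) (suc m) (subst (_≤ suc m + k) (sym a≡) a≤)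
  rec = GrowsFrom-unshift (m ⊔ (a ∸ k))
    (subst (λ n → GrowsFrom n w) (trans (cong (m + k ⊔_) (sym a≡)) (sym (+-distribʳ-⊔ k m (a ∸ k)))) g) k<
  v = proj₁ rec
  gv = proj₁ (proj₂ rec)
  eq = proj₂ (proj₂ rec)

-- Order isomorphism

StrictlyMonotoneOn : Word → (ℕ → ℕ) → Set
StrictlyMonotoneOn p g = ∀ {x y} → x ∈ p → y ∈ p → x < y → g x < g y

infix 4 _≅_

-- Order isomorphism as a relabelling of the pattern. Only the labels of letters of `p` are
-- constrained, so a shift is a composition of functions and a piece of the pattern keeps the same
-- labels.
record _≅_ (u p : Word) : Set where
  constructor relabelling
  field
    label    : ℕ → ℕ
    monotone : StrictlyMonotoneOn p label
    relabel  : u ≡ map label p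

lookup-map : ∀ (g : ℕ → ℕ) p .(eq : length (map g p) ≡ length p) i → lookup (map g p) i ≡ g (lookup p (cast eq i))
lookup-map g (x ∷ p) eq Fin.zero    = refl
lookup-map g (x ∷ p) eq (Fin.suc i) = lookup-map g p (suc-injective eq) i

≅⇒OrderIsomorphic : ∀ {u p} → u ≅ p → OrderIsomorphic u p
≅⇒OrderIsomorphic {p = p} (relabelling g mono refl) = eq , λ i j → mk⇔ (reflects i j) (preserves i j)
  where
  eq = length-map g p
  preserves : ∀ i j → lookup p (cast eq i) < lookup p (cast eq j) → lookup (map g p) i < lookup (map g p) j
  preserves i j x<y rewrite lookup-map g p eq i | lookup-map g p eq j =
    mono (∈-lookup {xs = p} _) (∈-lookup {xs = p} _) x<y
  reflects : ∀ i j → lookup (map g p) i < lookup (map g p) j → lookup p (cast eq i) < lookup p (cast eq j)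
  reflects i j gx<gy rewrite lookup-map g p eq i | lookup-map g p eq j
    with <-cmp (lookup p (cast eq i)) (lookup p (cast eq j))
  ... | tri< x<y _ _ = x<y
  ... | tri≈ _ x≡y _ = contradiction gx<gy (<-irrefl (cong g x≡y))
  ... | tri> _ _ y<x = contradiction gx<gy (<-asym (mono (∈-lookup {xs = p} _) (∈-lookup {xs = p} _) y<x))

OrderIsomorphic⇒≅ : ∀ {u p} → OrderIsomorphic u p → u ≅ p
OrderIsomorphic⇒≅ {u} {p} (eq , iso) = relabelling g mono
  (Pointwise-≡⇒≡ (lookup⁻ (trans eq (sym (length-map g p))) pw))
  where
  g : ℕ → ℕ
  -- Each letter of `p` receives the letter of `u` at some position where it occurs; 0 is a filler
  -- off `p`.
  g x with any? (λ i → lookup p (cast eq i) ≟ x)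
  ... | yes (i , _) = lookup u i
  ... | no  _       = 0
  -- The label does not depend on the chosen position: a strict inequality in `u`, either way, would
  -- carry over to `p`.
  same : ∀ i j → lookup p (cast eq i) ≡ lookup p (cast eq j) → lookup u i ≡ lookup u j
  same i j e with <-cmp (lookup u i) (lookup u j)
  ... | tri< l _ _ = contradiction (Equivalence.to (iso i j) l) (<-irrefl e)
  ... | tri≈ _ l _ = l
  ... | tri> _ _ l = contradiction (Equivalence.to (iso j i) l) (<-irrefl (sym e))
  g-lookup : ∀ i → g (lookup p (cast eq i)) ≡ lookup u i
  g-lookup i with any? (λ j → lookup p (cast eq j) ≟ lookup p (cast eq i))
  ... | yes (j , e) = same j i e
  ... | no  ∄       = contradiction (i , refl) ∄
  position : ∀ {x} → x ∈ p → ∃ λ i → x ≡ lookup p (cast eq i)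
  position x∈ = cast (sym eq) (Any.index x∈) ,
    trans (Any.lookup-index x∈) (cong (lookup p) (toℕ-injective (sym (trans (toℕ-cast eq _) (toℕ-cast (sym eq) _)))))
  mono : StrictlyMonotoneOn p g
  mono x∈ y∈ x<y with position x∈ | position y∈
  ... | i , refl | j , refl rewrite g-lookup i | g-lookup j = Equivalence.from (iso i j) x<y
  pw : ∀ {i j} → toℕ i ≡ toℕ j → lookup u i ≡ lookup (map g p) j
  pw {i} {j} e = sym (trans (lookup-map g p (length-map g p) j)
    (trans (cong (g ∘ lookup p) (toℕ-injective (trans (toℕ-cast _ j) (trans (sym e) (sym (toℕ-cast eq i)))))) (g-lookup i)))

contains : ∀ {u w p} → u ⊆ w → u ≅ p → Contains w p
contains u⊆w u≅p = _ , u⊆w , ≅⇒OrderIsomorphic u≅p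

Contains-⊆ : ∀ {v w p} → v ⊆ w → Contains v p → Contains w p
Contains-⊆ v⊆w (u , u⊆v , iso) = u , ⊆-trans u⊆v v⊆w , iso

≅-shift : ∀ {u p} k → u ≅ p → shift k u ≅ p
≅-shift {p = p} k (relabelling g mono refl) =
  relabelling ((_+ k) ∘ g) (λ x∈ y∈ x<y → +-monoˡ-< k (mono x∈ y∈ x<y)) (sym (map-∘ p))

≅-unshift : ∀ {u p} k → shift k u ≅ p → u ≅ p
≅-unshift {u} {p} k (relabelling g mono e) = relabelling ((_∸ k) ∘ g)
  (λ x∈ y∈ x<y → ∸-monoˡ-< (mono x∈ y∈ x<y) (k≤g x∈))
  (trans (trans (sym (map-id u)) (trans (map-cong (λ x → sym (m+n∸n≡m x k)) u) (map-∘ u)))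
    (trans (cong (map (_∸ k)) e) (sym (map-∘ p))))
  where
  -- Every label is a letter of the shifted word, hence at least `k`, so truncated subtraction keeps
  -- strict order.
  k≤g : ∀ {x} → x ∈ p → k ≤ g x
  k≤g x∈ with ∈-map⁻ (_+ k) (subst (g _ ∈_) (sym e) (∈-map⁺ g x∈))
  ... | y , _ , gx≡ = subst (k ≤_) (sym gx≡) (m≤n+m k y)

⊆-map⁻ : ∀ {A B : Set} {f : A → B} {u} w → u ⊆ map f w → ∃ λ v → v ⊆ w × u ≡ map f v
⊆-map⁻ []      []         = [] , [] , refl
⊆-map⁻ (x ∷ w) (refl ∷ s) = let v , t , e = ⊆-map⁻ w s in x ∷ v , refl ∷ t , cong (_ ∷_) e
⊆-map⁻ (x ∷ w) (_ ∷ʳ s)   = let v , t , e = ⊆-map⁻ w s in v , x ∷ʳ t , e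

Contains-shift⁺ : ∀ {w p} k → Contains w p → Contains (shift k w) p
Contains-shift⁺ {p = p} k (u , u⊆w , iso) = contains (map⁺ (_+ k) u⊆w) (≅-shift k (OrderIsomorphic⇒≅ {p = p} iso))

Contains-shift⁻ : ∀ {w p} k → Contains (shift k w) p → Contains w p
Contains-shift⁻ {w} {p} k (u , u⊆ , iso) with ⊆-map⁻ w u⊆
... | v , v⊆w , refl = contains v⊆w (≅-unshift k (OrderIsomorphic⇒≅ {p = p} iso))

map-++⁻ : ∀ {A B : Set} {f : A → B} u {v} p → map f p ≡ u ++ v →
  ∃ λ p₁ → ∃ λ p₂ → p ≡ p₁ ++ p₂ × u ≡ map f p₁ × v ≡ map f p₂
map-++⁻ []      p       e = [] , p , refl , refl , sym e
map-++⁻ (x ∷ u) (a ∷ p) e with map-++⁻ u p (cong (drop 1) e)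
... | p₁ , p₂ , e₁ , e₂ , e₃ = a ∷ p₁ , p₂ , cong (a ∷_) e₁ , cong₂ _∷_ (sym (proj₁ (∷-injective e))) e₂ , e₃

infix 4 _≺_

_≺_ : Word → Word → Set
u ≺ v = ∀ {x y} → x ∈ u → y ∈ v → x < y

map-≺⁻ : ∀ {g} u v → StrictlyMonotoneOn (u ++ v) g → map g u ≺ map g v → u ≺ v
map-≺⁻ {g} u v mono gu≺gv {x} {y} x∈ y∈ with <-cmp x y | gu≺gv (∈-map⁺ g x∈) (∈-map⁺ g y∈)
... | tri< x<y _ _ | _  = x<y
... | tri≈ _ x≡y _ | gl = contradiction gl (<-irrefl (cong g x≡y))
... | tri> _ _ y<x | gl = contradiction gl (<-asym (mono (∈-++⁺ʳ u y∈) (∈-++⁺ˡ x∈) y<x))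

-- All letters of `p₂` exceed the peak of `p₁`, which is its number of blocks; subtracting it leaves
-- a word that grows from 0.
≺-split : ∀ {p₁ p₂} → IsPartition (p₁ ++ p₂) → p₁ ≺ p₂ → ∃ λ β → IsPartition β × p₁ ++ p₂ ≡ p₁ ⟨ β ⟩
≺-split {p₁} {p₂} g p₁≺p₂ with GrowsFrom-++⁻ p₁ g
... | g₁ , g₂ with GrowsFrom-unshift 0 g₂ (All.tabulate λ y∈ →
                     peak-< p₁ (All.lookup (GrowsFrom-positive g₂) y∈) (All.tabulate λ x∈ → p₁≺p₂ x∈ y∈))
...   | β , gβ , refl = β , gβ , cong (λ k → p₁ ++ shift k β) (sym (blocks≡peak g₁))

-- Connectedness enters the proof here. A cut after which all letters are larger pulls back along
-- the monotone labels to a cut of `p`; with both sides nonempty, `≺-split` would make it a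
-- decomposition of `p`.
connected-split : ∀ {p} → IsPartition p → Connected p → ∀ u v → u ++ v ≅ p → u ≺ v → u ≡ [] ⊎ v ≡ []
connected-split part conn u v (relabelling g mono e) u≺v with map-++⁻ u _ (sym e)
... | []      , p₂      , refl , refl , refl = inj₁ refl
... | _ ∷ _   , []      , refl , refl , refl = inj₂ refl
... | x ∷ p₁  , y ∷ p₂  , refl , refl , refl with ≺-split part (map-≺⁻ (x ∷ p₁) (y ∷ p₂) mono u≺v)
... | β , gβ , eq = contradiction (x ∷ p₁ , β , proj₁ (GrowsFrom-++⁻ (x ∷ p₁) part) , gβ , (λ ()) , β≢[] , eq) conn
  where
  β≢[] : β ≢ []
  β≢[] refl with () ← ++-cancelˡ (x ∷ p₁) (y ∷ p₂) [] eq

-- Subwords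

⊆-++⁻ : ∀ {A : Set} {u : List A} xs {ys} → u ⊆ xs ++ ys → ∃ λ u₁ → ∃ λ u₂ → u ≡ u₁ ++ u₂ × u₁ ⊆ xs × u₂ ⊆ ys
⊆-++⁻ []       s          = [] , _ , refl , [] , s
⊆-++⁻ (x ∷ xs) (refl ∷ s) = let u₁ , u₂ , e , s₁ , s₂ = ⊆-++⁻ xs s in x ∷ u₁ , u₂ , cong (x ∷_) e , refl ∷ s₁ , s₂
⊆-++⁻ (x ∷ xs) (_ ∷ʳ s)   = let u₁ , u₂ , e , s₁ , s₂ = ⊆-++⁻ xs s in u₁ , u₂ , e , x ∷ʳ s₁ , s₂

-- Used to cut an occurrence of 1[σ]1[τ] at a boundary in the word: the cut falls either into the
-- first base with σ or into the second base with τ.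
++-⊆-++⁻ : ∀ {A : Set} (as : List A) {bs} xs {ys} → as ++ bs ⊆ xs ++ ys →
  (∃ λ a₁ → ∃ λ a₂ → as ≡ a₁ ++ a₂ × a₁ ⊆ xs × a₂ ++ bs ⊆ ys) ⊎
  (∃ λ b₁ → ∃ λ b₂ → bs ≡ b₁ ++ b₂ × as ++ b₁ ⊆ xs × b₂ ⊆ ys)
++-⊆-++⁻ []       xs       s          = inj₂ (⊆-++⁻ xs s)
++-⊆-++⁻ (a ∷ as) []       s          = inj₁ ([] , _ , refl , [] , s)
++-⊆-++⁻ (a ∷ as) (x ∷ xs) (_ ∷ʳ s)   with ++-⊆-++⁻ (a ∷ as) xs s
... | inj₁ (a₁ , a₂ , e , s₁ , s₂) = inj₁ (a₁ , a₂ , e , x ∷ʳ s₁ , s₂)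
... | inj₂ (b₁ , b₂ , e , s₁ , s₂) = inj₂ (b₁ , b₂ , e , x ∷ʳ s₁ , s₂)
++-⊆-++⁻ (a ∷ as) (x ∷ xs) (refl ∷ s) with ++-⊆-++⁻ as xs s
... | inj₁ (a₁ , a₂ , e , s₁ , s₂) = inj₁ (a ∷ a₁ , a₂ , cong (a ∷_) e , refl ∷ s₁ , s₂)
... | inj₂ (b₁ , b₂ , e , s₁ , s₂) = inj₂ (b₁ , b₂ , e , refl ∷ s₁ , s₂)

tail-⊆-tail : ∀ {A : Set} {x y : A} {xs ys} → x ∷ xs ⊆ y ∷ ys → xs ⊆ ys
tail-⊆-tail (_ ∷ʳ s) = ∷ˡ⁻ s
tail-⊆-tail (_ ∷ s)  = s

⊆-skip : ∀ {a v w} → All (a <_) v → v ⊆ a ∷ w → v ⊆ w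
⊆-skip _         (_ ∷ʳ s)   = s
⊆-skip (a<a ∷ _) (refl ∷ s) = contradiction a<a (<-irrefl refl)

head-∈ : ∀ {A : Set} {x : A} {xs ys} → x ∷ xs ⊆ ys → x ∈ ys
head-∈ s = Sublist.lookup s (here refl)

middle-∈ : ∀ {A : Set} {x : A} us {vs ys} → us ++ x ∷ vs ⊆ ys → x ∈ ys
middle-∈ us s = Sublist.lookup s (∈-++⁺ʳ us (here refl))

++-⊆ˡ : ∀ {A : Set} (us : List A) {vs ys} → us ++ vs ⊆ ys → us ⊆ ys
++-⊆ˡ us {vs} s = ⊆-trans (++⁺ʳ vs ⊆-refl) s

++-⊆ʳ : ∀ {A : Set} (us : List A) {vs ys} → us ++ vs ⊆ ys → vs ⊆ ys
++-⊆ʳ us s = ⊆-trans (++⁺ˡ us ⊆-refl) s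

-- Patterns

-- An occurrence of 1[σ]1[τ] taken apart, with `base` playing the letter 1. The order conditions are
-- kept apart from the two relabellings so that σ and τ can be cut independently.
record Arc (σ τ w : Word) : Set where
  constructor arc
  field
    base       : ℕ
    {under after} : Word
    occurrence : base ∷ under ++ base ∷ after ⊆ w
    under-≅    : under ≅ σ
    after-≅    : after ≅ τ
    base<under : All (base <_) under
    base<after : All (base <_) after
    ascending  : under ≺ after

-- The shift that the bracket notation puts on τ in 1[σ]1[τ].
arc-offset : Word → ℕ
arc-offset σ = blocks (1 ∷ shift 1 σ ++ 1 ∷ [])

1[]1[]-flat : ∀ σ τ → 1[ σ ]1[ τ ] ≡ 1 ∷ shift 1 σ ++ 1 ∷ shift (arc-offset σ) τ
1[]1[]-flat σ τ = cong (1 ∷_) (++-assoc (shift 1 σ) (1 ∷ []) _)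

-- Since 1[σ]1 is again a partition, its number of blocks is its maximum. This places the shifted τ
-- above the shifted σ.
arc-offset-≥ : ∀ {σ x} → IsPartition σ → x ∈ σ → x + 1 ≤ arc-offset σ
arc-offset-≥ {σ} {x} g x∈ = subst (x + 1 ≤_) (sym (blocks≡peak part))
  (All.lookup (All-≤-peak 0 (1 ∷ shift 1 σ ++ 1 ∷ [])) (there (∈-++⁺ˡ (∈-map⁺ (_+ 1) x∈))))
  where
  part : IsPartition (1 ∷ shift 1 σ ++ 1 ∷ [])
  part = (s≤s z≤n , s≤s z≤n) ∷ GrowsFrom-++⁺ (GrowsFrom-shift g) ((s≤s z≤n , s≤s z≤n) ∷ [])

module _ {σ τ : Word} (σ-part : IsPartition σ) (τ-part : IsPartition τ) where

  private
    R : ℕ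
    R = arc-offset σ

    P : Word
    P = 1 ∷ shift 1 σ ++ 1 ∷ shift R τ

    in-σ : ∀ {x} → x ∈ σ → x + 1 ∈ P
    in-σ x∈ = there (∈-++⁺ˡ (∈-map⁺ (_+ 1) x∈))

    in-τ : ∀ {x} → x ∈ τ → x + R ∈ P
    in-τ x∈ = there (∈-++⁺ʳ (shift 1 σ) (there (∈-map⁺ (_+ R) x∈)))

    σ-pos : ∀ {x} → x ∈ σ → 1 ≤ x
    σ-pos = All.lookup (GrowsFrom-positive σ-part)

    τ-pos : ∀ {x} → x ∈ τ → 1 ≤ x
    τ-pos = All.lookup (GrowsFrom-positive τ-part)

    σ<τ : ∀ {x y} → x ∈ σ → y ∈ τ → x + 1 < y + R
    σ<τ x∈ y∈ = +-mono-≤ (τ-pos y∈) (arc-offset-≥ σ-part x∈)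

    1<τ : ∀ {y} → y ∈ τ → 1 < y + R
    1<τ y∈ = +-mono-≤ (τ-pos y∈) (s≤s z≤n)

    1<σ : ∀ {x} → x ∈ σ → 1 < x + 1
    1<σ x∈ = +-monoˡ-≤ 1 (σ-pos x∈)

  Contains⇒Arc : ∀ {w} → Contains w 1[ σ ]1[ τ ] → Arc σ τ w
  Contains⇒Arc {w} (u , u⊆w , iso) with OrderIsomorphic⇒≅ {u} {P} (subst (OrderIsomorphic u) (1[]1[]-flat σ τ) iso)
  ... | relabelling g mono refl = record
    { base       = g 1
    ; occurrence = subst (_⊆ w) (cong (g 1 ∷_) (trans (map-++ g (shift 1 σ) _)
                     (cong₂ (λ u v → u ++ g 1 ∷ v) (sym (map-∘ σ)) (sym (map-∘ τ))))) u⊆w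
    ; under-≅    = relabelling _ (λ x∈ y∈ x<y → mono (in-σ x∈) (in-σ y∈) (+-monoˡ-< 1 x<y)) refl
    ; after-≅    = relabelling _ (λ x∈ y∈ x<y → mono (in-τ x∈) (in-τ y∈) (+-monoˡ-< R x<y)) refl
    ; base<under = All.map⁺ (All.tabulate λ x∈ → mono (here refl) (in-σ x∈) (1<σ x∈))
    ; base<after = All.map⁺ (All.tabulate λ x∈ → mono (here refl) (in-τ x∈) (1<τ x∈))
    ; ascending  = asc
    }
    where
    asc : map (g ∘ (_+ 1)) σ ≺ map (g ∘ (_+ R)) τ
    asc x∈ y∈ with ∈-map⁻ _ x∈ | ∈-map⁻ _ y∈
    ... | x , x∈σ , refl | y , y∈τ , refl = mono (in-σ x∈σ) (in-τ y∈τ) (σ<τ x∈σ y∈τ)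

  Arc⇒Contains : ∀ {w} → Arc σ τ w → Contains w 1[ σ ]1[ τ ]
  Arc⇒Contains {w} (arc b s (relabelling g₁ mono₁ refl) (relabelling g₂ mono₂ refl) b<₁ b<₂ asc) =
    subst (Contains w) (sym (1[]1[]-flat σ τ)) (contains s (relabelling {p = P} g mono (sym g-P)))
    where
    -- The letters of `P` fall into three ranges: 1, then 2 to `R` from σ, then those above `R` from
    -- τ. The given relabellings are glued along these ranges.
    g : ℕ → ℕ
    g x with x ≤? 1
    ... | yes _ = b
    ... | no _ with x ≤? R
    ...   | yes _ = g₁ (x ∸ 1)
    ...   | no  _ = g₂ (x ∸ R)

    g-σ : ∀ {x} → x ∈ σ → g (x + 1) ≡ g₁ x
    g-σ {x} x∈ with x + 1 ≤? 1
    ... | yes ≤1 = contradiction (<-≤-trans (1<σ x∈) ≤1) (<-irrefl refl)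
    ... | no _ with x + 1 ≤? R
    ...   | yes _  = cong g₁ (m+n∸n≡m x 1)
    ...   | no ≰R = contradiction (arc-offset-≥ σ-part x∈) ≰R

    g-τ : ∀ {x} → x ∈ τ → g (x + R) ≡ g₂ x
    g-τ {x} x∈ with x + R ≤? 1
    ... | yes ≤1 = contradiction (<-≤-trans (1<τ x∈) ≤1) (<-irrefl refl)
    ... | no _ with x + R ≤? R
    ...   | yes ≤R = contradiction (≤-trans (+-monoˡ-≤ R (τ-pos x∈)) ≤R) (<-irrefl refl)
    ...   | no _   = cong g₂ (m+n∸n≡m x R)

    g-P : map g P ≡ b ∷ map g₁ σ ++ b ∷ map g₂ τ
    g-P = cong (b ∷_) (trans (map-++ g (shift 1 σ) _) (cong₂ (λ u v → u ++ b ∷ v)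
      (trans (sym (map-∘ σ)) (map-cong-local (All.tabulate g-σ)))
      (trans (sym (map-∘ τ)) (map-cong-local (All.tabulate g-τ)))))

    data Letter : ℕ → Set where
      one : Letter 1
      ofσ : ∀ {x} → x ∈ σ → Letter (x + 1)
      ofτ : ∀ {x} → x ∈ τ → Letter (x + R)

    letter? : ∀ {x} → x ∈ P → Letter x
    letter? (here refl) = one
    letter? (there x∈) with ∈-++⁻ (shift 1 σ) x∈
    ... | inj₂ (here refl) = one
    ... | inj₁ x∈ₗ with ∈-map⁻ _ x∈ₗ
    ...   | _ , x∈σ , refl = ofσ x∈σ
    letter? (there x∈) | inj₂ (there x∈ᵣ) with ∈-map⁻ _ x∈ᵣ
    ...   | _ , x∈τ , refl = ofτ x∈τ

    mono′ : ∀ {x y} → Letter x → Letter y → x < y → g x < g y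
    mono′ one       one       x<y = contradiction x<y (<-irrefl refl)
    mono′ one       (ofσ y∈) x<y = subst (b <_) (sym (g-σ y∈)) (All.lookup b<₁ (∈-map⁺ g₁ y∈))
    mono′ one       (ofτ y∈) x<y = subst (b <_) (sym (g-τ y∈)) (All.lookup b<₂ (∈-map⁺ g₂ y∈))
    mono′ (ofσ x∈) one       x<y = contradiction (1<σ x∈) (<-asym x<y)
    mono′ (ofσ x∈) (ofσ y∈) x<y = subst₂ _<_ (sym (g-σ x∈)) (sym (g-σ y∈)) (mono₁ x∈ y∈ (+-cancelʳ-< 1 _ _ x<y))
    mono′ (ofσ x∈) (ofτ y∈) x<y = subst₂ _<_ (sym (g-σ x∈)) (sym (g-τ y∈)) (asc (∈-map⁺ g₁ x∈) (∈-map⁺ g₂ y∈))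
    mono′ (ofτ x∈) one       x<y = contradiction (1<τ x∈) (<-asym x<y)
    mono′ (ofτ x∈) (ofσ y∈) x<y = contradiction (σ<τ y∈ x∈) (<-asym x<y)
    mono′ (ofτ x∈) (ofτ y∈) x<y = subst₂ _<_ (sym (g-τ x∈)) (sym (g-τ y∈)) (mono₂ x∈ y∈ (+-cancelʳ-< R _ _ x<y))

    mono : StrictlyMonotoneOn P g
    mono x∈ y∈ = mono′ (letter? x∈) (letter? y∈)

Crossing : Word → Set
Crossing w = ∃ λ b → ∃ λ c → b < c × b ∷ c ∷ b ∷ c ∷ [] ⊆ w

Contains1212⇒Crossing : ∀ {w} → Contains w ⟨1212⟩ → Crossing w
Contains1212⇒Crossing (u , s , iso) with OrderIsomorphic⇒≅ {u} {⟨1212⟩} iso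
... | relabelling g mono refl = g 1 , g 2 , mono (here refl) (there (here refl)) (s≤s (s≤s z≤n)) , s

Crossing⇒Contains1212 : ∀ {w} → Crossing w → Contains w ⟨1212⟩
Crossing⇒Contains1212 (b , c , b<c , s) = contains s (relabelling g mono refl)
  where
  g : ℕ → ℕ
  g 1 = b
  g _ = c
  12s : ∀ {x} → x ∈ ⟨1212⟩ → x ≡ 1 ⊎ x ≡ 2
  12s (here e)                         = inj₁ e
  12s (there (here e))                 = inj₂ e
  12s (there (there (here e)))         = inj₁ e
  12s (there (there (there (here e)))) = inj₂ e
  mono : StrictlyMonotoneOn ⟨1212⟩ g
  mono x∈ y∈ x<y with 12s x∈ | 12s y∈
  ... | inj₁ refl | inj₁ refl = contradiction x<y (<-irrefl refl)
  ... | inj₁ refl | inj₂ refl = b<c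
  ... | inj₂ refl | inj₁ refl = contradiction x<y λ { (s≤s ()) }
  ... | inj₂ refl | inj₂ refl = contradiction x<y (<-irrefl refl)

-- Non-crossing partitions as trees

-- Each child contributes one letter of the root's block followed by its own word, so letters
-- correspond to edges and the childless node is the empty partition.
data Tree : Set where
  node : List Tree → Tree

-- word m t is the partition of t shifted by m; arcs a m (w₁ … wₖ) is a[w₁]a[w₂]…a[wₖ], where a has
-- already been opened and m is the largest letter so far.
mutual
  word : ℕ → Tree → Word
  word m (node ts) = arcs (suc m) (suc m) ts

  arcs : ℕ → ℕ → List Tree → Word
  arcs a m []       = []
  arcs a m (t ∷ ts) = a ∷ word m t ++ arcs a (peak m (word m t)) ts

mutual
  word-shift : ∀ k m t → word (m + k) t ≡ shift k (word m t)
  word-shift k m (node ts) = arcs-shift k (suc m) (suc m) ts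

  arcs-shift : ∀ k a m ts → arcs (a + k) (m + k) ts ≡ shift k (arcs a m ts)
  arcs-shift k a m []       = refl
  arcs-shift k a m (t ∷ ts) rewrite word-shift k m t | peak-shift k m (word m t) | arcs-shift k a (peak m (word m t)) ts =
    cong (a + k ∷_) (sym (map-++ (_+ k) (word m t) _))

Has : Word → Tree → Set
Has p t = Contains (word 0 t) p

Has⇒Contains : ∀ {p} m t → Has p t → Contains (word m t) p
Has⇒Contains {p} m t h = subst (λ w → Contains w p) (sym (word-shift m 0 t)) (Contains-shift⁺ {p = p} m h)

Contains⇒Has : ∀ {p} m t → Contains (word m t) p → Has p t
Contains⇒Has {p} m t c = Contains-shift⁻ {p = p} m (subst (λ w → Contains w p) (word-shift m 0 t) c)

-- Blocks numbered above `a` and up to `m` are closed for good: only `a` itself returns.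
OnArcs : ℕ → ℕ → ℕ → Set
OnArcs a m x = x ≡ a ⊎ m < x

mutual
  word-> : ∀ m t → All (m <_) (word m t)
  word-> m (node ts) = All.map [ (λ { refl → ≤-refl }) , <⇒≤ ]′ (arcs-OnArcs (suc m) (suc m) ts)

  arcs-OnArcs : ∀ a m ts → All (OnArcs a m) (arcs a m ts)
  arcs-OnArcs a m []       = []
  arcs-OnArcs a m (t ∷ ts) = inj₁ refl ∷ All.++⁺ (All.map inj₂ (word-> m t))
    (All.map [ inj₁ , inj₂ ∘ ≤-<-trans (≤-peak m (word m t)) ]′ (arcs-OnArcs a (peak m (word m t)) ts))

mutual
  word-grows : ∀ m t → GrowsFrom m (word m t)
  word-grows m (node [])       = []
  word-grows m (node (t ∷ ts)) with arcs-grows (s≤s z≤n) ≤-refl (t ∷ ts)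
  ... | _ ∷ g = (s≤s z≤n , ≤-refl) ∷ subst (λ n → GrowsFrom n (word (suc m) t ++ arcs (suc m) m′ ts))
                  (trans (⊔-idem (suc m)) (sym (m≤n⇒m⊔n≡n (n≤1+n m)))) g
    where m′ = peak (suc m) (word (suc m) t)

  arcs-grows : ∀ {a m} → 1 ≤ a → a ≤ m → ∀ ts → GrowsFrom m (arcs a m ts)
  arcs-grows 1≤a a≤m []               = []
  arcs-grows {a} {m} 1≤a a≤m (t ∷ ts) = (1≤a , ≤-trans a≤m (n≤1+n m)) ∷
    subst (λ n → GrowsFrom n (word m t ++ arcs a (peak m (word m t)) ts)) (sym (m≥n⇒m⊔n≡m a≤m))
      (GrowsFrom-++⁺ (word-grows m t) (arcs-grows 1≤a (≤-trans a≤m (≤-peak m (word m t))) ts))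

-- The boundary after the first subtree

module Step {a m : ℕ} (a≤m : a ≤ m) (t : Tree) (ts : List Tree) where

  E = word m t
  m′ = peak m E
  S = arcs a m′ ts

  a≤m′ : a ≤ m′
  a≤m′ = ≤-trans a≤m (≤-peak m E)

  E-≤ : ∀ {x} → x ∈ E → x ≤ m′
  E-≤ = All.lookup (All-≤-peak m E)

  E-> : ∀ {x} → x ∈ E → a < x
  E-> x∈ = ≤-<-trans a≤m (All.lookup (word-> m t) x∈)

  aE-≤ : ∀ {x} → x ∈ a ∷ E → x ≤ m′
  aE-≤ (here refl) = a≤m′
  aE-≤ (there x∈)  = E-≤ x∈

  S-> : ∀ {x} → x ∈ S → a < x → m′ < x
  S-> x∈ a<x with All.lookup (arcs-OnArcs a m′ ts) x∈
  ... | inj₁ refl = contradiction a<x (<-irrefl refl)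
  ... | inj₂ m′<x = m′<x

  -- New letters of `S` exceed `m′`, which bounds `a ∷ E`, so the open block alone continues past
  -- the boundary. The cutting arguments below rest on this.
  common≡a : ∀ {x} → x ∈ a ∷ E → x ∈ S → x ≡ a
  common≡a x∈E x∈S with All.lookup (arcs-OnArcs a m′ ts) x∈S
  ... | inj₁ x≡a  = x≡a
  ... | inj₂ m′<x = contradiction (aE-≤ x∈E) (<⇒≱ m′<x)

  E≺S : ∀ {u v} → u ⊆ E → v ⊆ S → All (a <_) v → u ≺ v
  E≺S u⊆ v⊆ a<v x∈ y∈ = ≤-<-trans (E-≤ (Sublist.lookup u⊆ x∈)) (S-> (Sublist.lookup v⊆ y∈) (All.lookup a<v y∈))

  found : ∀ {u p} → u ⊆ E → u ≅ p → Has p t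
  found {p = p} u⊆E u≅p = Contains⇒Has {p} m t (contains u⊆E u≅p)

module Connected-pattern {p : Word} (part : IsPartition p) (conn : Connected p) where

  -- At the boundary after `t` the letters above `a` jump upwards, so by `connected-split` the
  -- occurrence lies on one side. The list is nonempty because even an empty pattern needs a subtree
  -- to occur in.
  under-arcs : ∀ {a m} → a ≤ m → ∀ t ts {v} → v ⊆ arcs a m (t ∷ ts) → All (a <_) v → v ≅ p → Any (Has p) (t ∷ ts)
  under-arcs {a} {m} a≤m t ts v⊆ a<v v≅p with ⊆-++⁻ (word m t) (⊆-skip a<v v⊆)
  ... | v₁ , v₂ , refl , v₁⊆ , v₂⊆
    with connected-split part conn v₁ v₂ v≅p (Step.E≺S a≤m t ts v₁⊆ v₂⊆ (All.++⁻ʳ v₁ a<v))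
  ... | inj₂ refl = here (Step.found a≤m t ts v₁⊆ (subst (_≅ p) (++-identityʳ v₁) v≅p))
  ... | inj₁ refl = later ts v₂⊆
    where
    later : ∀ ts → v₂ ⊆ arcs a (peak m (word m t)) ts → Any (Has p) (t ∷ ts)
    later (s ∷ ss) v₂⊆ = there (under-arcs (Step.a≤m′ a≤m t ts) s ss v₂⊆ a<v v≅p)
    -- No subtree is left, so the pattern is empty and `t` contains it.
    later []       []  = here (Step.found a≤m t ts (minimum _) v≅p)

-- The leading `a` and the bound by `m` are recorded so that the occurrence can serve as the second
-- half of an arc with base `a`.
under-arcs⁻ : ∀ {p a} m {ts} → Any (Has p) ts → ∃ λ v → a ∷ v ⊆ arcs a m ts × v ≅ p × All (m <_) v
under-arcs⁻ {p} m {t ∷ ts} (here h) with Has⇒Contains {p} m t h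
... | u , u⊆ , iso = u , refl ∷ ++⁺ʳ _ u⊆ , OrderIsomorphic⇒≅ {u} {p} iso , All-resp-⊆ u⊆ (word-> m t)
under-arcs⁻ {a = a} m {t ∷ ts} (there h) with under-arcs⁻ {a = a} (peak m (word m t)) h
... | v , v⊆ , v≅ , <v = v , a ∷ʳ ++⁺ˡ (word m t) v⊆ , v≅ , All.map (≤-<-trans (≤-peak m (word m t))) <v

mutual
  word-nc : ∀ m t → ¬ Crossing (word m t)
  word-nc m (node ts) = arcs-nc ≤-refl ts

  arcs-nc : ∀ {a m} → a ≤ m → ∀ ts → ¬ Crossing (arcs a m ts)
  arcs-nc {a} {m} a≤m (t ∷ ts) (b , c , b<c , s) = go (⊆-++⁻ (a ∷ E) s)
    where
    open Step a≤m t ts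
    bc-aE : ∀ {v} → b ∷ c ∷ v ⊆ a ∷ E → c ∈ E
    bc-aE s = head-∈ (tail-⊆-tail s)
    go : (∃ λ u₁ → ∃ λ u₂ → b ∷ c ∷ b ∷ c ∷ [] ≡ u₁ ++ u₂ × u₁ ⊆ a ∷ E × u₂ ⊆ S) → ⊥
    go ([] , _ , refl , _ , s₂) = arcs-nc a≤m′ ts (b , c , b<c , s₂)
    -- Here b lies on both sides and so equals `a`; as `S` itself starts with `a`, the crossing can
    -- be restarted inside `S`.
    go (_ ∷ [] , _ , refl , s₁ , s₂) with common≡a (head-∈ s₁) (middle-∈ (c ∷ []) s₂)
    ... | refl = arcs-nc a≤m′ ts (a , c , b<c , headed ts s₂)
      where
      headed : ∀ ts {m} → c ∷ a ∷ c ∷ [] ⊆ arcs a m ts → a ∷ c ∷ a ∷ c ∷ [] ⊆ arcs a m ts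
      headed (_ ∷ _) (refl ∷ _) = contradiction b<c (<-irrefl refl)
      headed (_ ∷ _) (_ ∷ʳ s)   = refl ∷ s
    -- In this case and the next, c lies on both sides; but it follows another letter in `a ∷ E`, so
    -- it lies in `E` and exceeds `a`.
    go (_ ∷ _ ∷ [] , _ , refl , s₁ , s₂) with common≡a (there (bc-aE s₁)) (middle-∈ (b ∷ []) s₂)
    ... | refl = contradiction (E-> (bc-aE s₁)) (<-irrefl refl)
    go (_ ∷ _ ∷ _ ∷ [] , _ , refl , s₁ , s₂) with common≡a (there (bc-aE s₁)) (head-∈ s₂)
    ... | refl = contradiction (E-> (bc-aE s₁)) (<-irrefl refl)
    -- The second b follows other letters and so lies in `E`: neither letter is `a`, and the whole
    -- crossing lies in the subtree.
    go (_ ∷ _ ∷ _ ∷ _ ∷ [] , [] , refl , s₁ , _) = word-nc m t (b , c , b<c , ⊆-skip (a<b ∷ E-> c∈ ∷ a<b ∷ E-> c∈ ∷ []) s₁)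
      where
      c∈ = bc-aE s₁
      a<b = E-> (middle-∈ (c ∷ []) (tail-⊆-tail s₁))
    go (_ ∷ _ ∷ _ ∷ _ ∷ _ ∷ _ , _ , () , _)

-- Avoidance of 1[σ]1[τ] in terms of subtrees

module Avoidance {σ τ : Word} (σ-part : IsPartition σ) (σ-conn : Connected σ)
                 (τ-part : IsPartition τ) (τ-conn : Connected τ) where

  P : Word
  P = 1[ σ ]1[ τ ]

  -- For `s` to the left of its sibling `t`: the excluded situation gives an arc based on the letter
  -- of their parent.
  Ordered : Tree → Tree → Set
  Ordered s t = ¬ (Has σ s × Has τ t)

  -- The occurrence is cut at the boundary after `t`. Connectedness moves σ or τ wholly to one side;
  -- then the occurrence lies in `t`, or in the remaining arcs, or has σ in `t` and τ in a later
  -- subtree.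
  no-arc : ∀ {a m} → a ≤ m → ∀ ts → All (¬_ ∘ Has P) ts → AllPairs Ordered ts → ¬ Arc σ τ (arcs a m ts)
  no-arc {a} {m} a≤m (t ∷ ts) (∉t ∷ ∉ts) (ord ∷ ords) (arc b {u} {v} s u≅ v≅ b<u b<v u≺v) =
    [ before , after ]′ (++-⊆-++⁻ (b ∷ u) (a ∷ E) s)
    where
    open Step a≤m t ts

    -- Some later subtree must exist to hold τ, even an empty one: either `a` returns in `S`, or the
    -- occurrence of τ has a letter in `S`.
    later : ∀ ts → a ∈ arcs a m′ ts ⊎ v ≢ [] → v ⊆ arcs a m′ ts → All (a <_) v → All (Ordered t) ts → ¬ Has σ t
    later (t′ ∷ ts′) _           v⊆ a<v ord h = All.lookupWith (λ { o hτ → o (h , hτ) }) ord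
      (Connected-pattern.under-arcs τ-part τ-conn a≤m′ t′ ts′ v⊆ a<v v≅)
    later []         (inj₁ ())   _  _   _   _
    later []         (inj₂ v≢[]) [] _   _   _ = v≢[] refl

    restart : ∀ ts {m c w} → a < c → c ∷ w ⊆ arcs a m ts → a ∷ c ∷ w ⊆ arcs a m ts
    restart (_ ∷ _) a<c (refl ∷ _) = contradiction a<c (<-irrefl refl)
    restart (_ ∷ _) a<c (_ ∷ʳ s)   = refl ∷ s

    split-under : ∀ u₁ u₂ → u ≡ u₁ ++ u₂ → b ∷ u₁ ⊆ a ∷ E → u₂ ++ b ∷ v ⊆ S → ⊥
    split-under u₁ [] refl s₁ s₂ with common≡a (head-∈ s₁) (head-∈ s₂)
    ... | refl = later ts (inj₁ (head-∈ s₂)) (∷ˡ⁻ s₂) b<v ord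
                   (found (tail-⊆-tail s₁) (subst (_≅ σ) (++-identityʳ u₁) u≅))
    split-under u₁ (c ∷ u₂) refl s₁ s₂ with common≡a (head-∈ s₁) (middle-∈ (c ∷ u₂) s₂)
    ... | refl with connected-split σ-part σ-conn u₁ (c ∷ u₂) u≅
                      (E≺S (tail-⊆-tail s₁) (++-⊆ˡ (c ∷ u₂) s₂) (All.++⁻ʳ u₁ b<u))
    -- All of σ lies after the boundary, so the first base can be replaced by the `a` that opens
    -- `S`.
    ... | inj₁ refl = no-arc a≤m′ ts ∉ts ords (arc a (restart ts (All.head b<u) s₂) u≅ v≅ b<u b<v u≺v)

    before : (∃ λ u₁ → ∃ λ u₂ → b ∷ u ≡ u₁ ++ u₂ × u₁ ⊆ a ∷ E × u₂ ++ b ∷ v ⊆ S) → ⊥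
    before ([]     , _  , refl , _  , s₂) = no-arc a≤m′ ts ∉ts ords (arc b s₂ u≅ v≅ b<u b<v u≺v)
    before (_ ∷ u₁ , u₂ , e    , s₁ , s₂) with ∷-injective e
    ... | refl , e′ = split-under u₁ u₂ e′ s₁ s₂

    after : (∃ λ v₁ → ∃ λ v₂ → b ∷ v ≡ v₁ ++ v₂ × (b ∷ u) ++ v₁ ⊆ a ∷ E × v₂ ⊆ S) → ⊥
    after ([]     , _  , refl , s₁ , s₂) = split-under u [] (sym (++-identityʳ u))
      (subst (λ w → b ∷ w ⊆ a ∷ E) (++-identityʳ u) s₁) s₂
    after (_ ∷ v₁ , v₂ , e    , s₁ , s₂) with ∷-injective e
    ... | refl , refl = split-after
      where
      -- The second base lies in `E`, so the base is not `a` and all letters of the occurrence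
      -- exceed `a`.
      a<b : a < b
      a<b = E-> (middle-∈ u (tail-⊆-tail s₁))
      a<u : All (a <_) u
      a<u = All.map (<-trans a<b) b<u
      a<v : All (a <_) v
      a<v = All.map (<-trans a<b) b<v
      s₁′ : b ∷ u ++ b ∷ v₁ ⊆ E
      s₁′ = ⊆-skip (a<b ∷ All.++⁺ a<u (a<b ∷ All.++⁻ˡ v₁ a<v)) s₁
      v₁⊆E : v₁ ⊆ E
      v₁⊆E = ∷ˡ⁻ (++-⊆ʳ u (∷ˡ⁻ s₁′))
      whole : v₁ ≢ v₁ ++ v₂
      whole e = ∉t (Contains⇒Has {P} m t (Arc⇒Contains σ-part τ-part
        (arc b (subst (λ v → b ∷ u ++ b ∷ v ⊆ E) e s₁′) u≅ v≅ b<u b<v u≺v)))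
      split-after : ⊥
      split-after with connected-split τ-part τ-conn v₁ v₂ v≅ (E≺S v₁⊆E s₂ (All.++⁻ʳ v₁ a<v))
      ... | inj₂ refl = whole (sym (++-identityʳ v₁))
      -- Here `v₂` is nonempty, since with τ empty the arc would already lie in `E`.
      ... | inj₁ refl = later ts (inj₂ (whole ∘ sym)) s₂ a<v ord (found (++-⊆ˡ u (∷ˡ⁻ s₁′)) u≅)

  -- If σ lies in `t` and τ in a later subtree, the copies of `a` in front of these two subtrees
  -- complete them to an arc.
  arcs-avoid⁻ : ∀ a m ts → ¬ Contains (arcs a m ts) P → a ≤ m → All (¬_ ∘ Has P) ts × AllPairs Ordered ts
  arcs-avoid⁻ a m []       _  _   = [] , []
  arcs-avoid⁻ a m (t ∷ ts) ∌P a≤m =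
    let ∉ts , ords = arcs-avoid⁻ a m′ ts (∌P ∘ Contains-⊆ {p = P} (a ∷ʳ ++⁺ˡ E ⊆-refl)) a≤m′
    in (λ h → ∌P (Contains-⊆ {p = P} (a ∷ʳ ++⁺ʳ S ⊆-refl) (Has⇒Contains {P} m t h))) ∷ ∉ts , All.tabulate ordered ∷ ords
    where
    open Step a≤m t ts
    ordered : ∀ {s} → s ∈ ts → Ordered t s
    ordered s∈ (hσ , hτ) with Has⇒Contains {σ} m t hσ | under-arcs⁻ {τ} {a} m′ (Any.map (λ { refl → hτ }) s∈)
    ... | u , u⊆ , iso | v , v⊆ , v≅ , m′<v = ∌P (Arc⇒Contains σ-part τ-part
      (arc a (refl ∷ ++⁺ u⊆ v⊆) (OrderIsomorphic⇒≅ {u} {σ} iso) v≅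
        (All.tabulate (E-> ∘ Sublist.lookup u⊆)) (All.map (≤-<-trans a≤m′) m′<v)
        (λ x∈ y∈ → ≤-<-trans (E-≤ (Sublist.lookup u⊆ x∈)) (All.lookup m′<v y∈))))

  avoids⁺ : ∀ ts → All (¬_ ∘ Has P) ts → AllPairs Ordered ts → ¬ Has P (node ts)
  avoids⁺ ts ∉ts ords h = no-arc ≤-refl ts ∉ts ords (Contains⇒Arc σ-part τ-part h)

  avoids⁻ : ∀ ts → ¬ Has P (node ts) → All (¬_ ∘ Has P) ts × AllPairs Ordered ts
  avoids⁻ ts ∌P = arcs-avoid⁻ 1 1 ts ∌P ≤-refl

  Has⇒Has-σ : ∀ t → Has P t → Has σ t
  Has⇒Has-σ t h with Contains⇒Arc σ-part τ-part h
  ... | arc b s u≅ _ _ _ _ = contains (++-⊆ˡ _ (∷ˡ⁻ s)) u≅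

  Has⇒Has-τ : ∀ t → Has P t → Has τ t
  Has⇒Has-τ t h with Contains⇒Arc σ-part τ-part h
  ... | arc b {u} s _ v≅ _ _ _ = contains (∷ˡ⁻ (++-⊆ʳ u (∷ˡ⁻ s))) v≅

Has-node⁺ : ∀ {p} → ∀ a m ts → Any (Has p) ts → Contains (arcs a m ts) p
Has-node⁺ {p} a m ts h = let v , v⊆ , v≅ , _ = under-arcs⁻ {p} {a} m h in contains (∷ˡ⁻ v⊆) v≅

-- Unique decoding

-- A subtree uses only letters above `a`, and what follows it is empty or resumes with `a`; hence
-- the boundary can be read off the word.
data StartsWith (a : ℕ) : Word → Set where
  []  : StartsWith a []
  at  : ∀ {w} → StartsWith a (a ∷ w)

arcs-StartsWith : ∀ a m ts → StartsWith a (arcs a m ts)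
arcs-StartsWith a m []       = []
arcs-StartsWith a m (t ∷ ts) = at

split-unique : ∀ {a u u′ r r′} → All (a <_) u → All (a <_) u′ → StartsWith a r → StartsWith a r′ →
  u ++ r ≡ u′ ++ r′ → u ≡ u′ × r ≡ r′
split-unique []        []        _ _ e = refl , e
split-unique []        (a<a ∷ _) at _ refl = contradiction a<a (<-irrefl refl)
split-unique (a<a ∷ _) []        _ at refl = contradiction a<a (<-irrefl refl)
split-unique (_ ∷ a<u) (_ ∷ a<u′) s s′ e with ∷-injective e
... | refl , e′ with split-unique a<u a<u′ s s′ e′
...   | refl , e″ = refl , e″

mutual
  word-injective : ∀ m t t′ → word m t ≡ word m t′ → t ≡ t′
  word-injective m (node ts) (node ts′) e = cong node (arcs-injective ≤-refl ts ts′ e)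

  arcs-injective : ∀ {a m} → a ≤ m → ∀ ts ts′ → arcs a m ts ≡ arcs a m ts′ → ts ≡ ts′
  arcs-injective a≤m []       []         e = refl
  arcs-injective {a} {m} a≤m (t ∷ ts) (t′ ∷ ts′) e
    with split-unique (All.map (≤-<-trans a≤m) (word-> m t)) (All.map (≤-<-trans a≤m) (word-> m t′))
           (arcs-StartsWith _ _ ts) (arcs-StartsWith _ _ ts′) (proj₂ (∷-injective e))
  ... | eE , eS with word-injective m t t′ eE
  ...   | refl = cong (t ∷_) (arcs-injective (≤-trans a≤m (≤-peak m (word m t))) ts ts′ eS)

split-at : ∀ {a w} → All (a ≤_) w → ∃ λ u → ∃ λ r → w ≡ u ++ r × All (a <_) u × StartsWith a r
split-at [] = [] , [] , refl , [] , []
split-at {a} {x ∷ w} (a≤x ∷ a≤) with a ≟ x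
... | yes refl = [] , _ , refl , [] , at
... | no a≢x = let u , r , e , a<u , s = split-at a≤ in x ∷ u , r , cong (x ∷_) e , ≤∧≢⇒< a≤x a≢x ∷ a<u , s

Crossing-⊆ : ∀ {v w} → v ⊆ w → Crossing v → Crossing w
Crossing-⊆ v⊆w (b , c , b<c , s) = b , c , b<c , ⊆-trans s v⊆w

mutual
  -- The word is cut at the returns of its first letter and the pieces are decoded in turn. They are
  -- not structural subterms, so the recursion runs on a bound `n` for the length.
  decode-word : ∀ n {m w} → length w ≤ n → GrowsFrom m w → All (m <_) w → ¬ Crossing w → ∃ λ t → word m t ≡ w
  decode-word n {w = []} _ _ _ _ = node [] , refl
  -- The first letter exceeds `m`, and by one at most, so it is `suc m`.
  decode-word n {m} {x ∷ w} len ((_ , x≤) ∷ g) (m<x ∷ m<w) nc with ≤-antisym x≤ m<x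
  ... | refl = let ts , e = decode-arcs n len (s≤s z≤n) ≤-refl grows (inj₁ refl ∷ All.map onArcs m<w) nc at in node ts , e
    where
    grows : GrowsFrom (suc m) (suc m ∷ w)
    grows = (s≤s z≤n , n≤1+n (suc m)) ∷ subst (λ k → GrowsFrom k w) (trans (m≤n⇒m⊔n≡n (n≤1+n m)) (sym (⊔-idem (suc m)))) g
    onArcs : ∀ {y} → m < y → OnArcs (suc m) (suc m) y
    onArcs m<y = [ inj₂ , inj₁ ∘ sym ]′ (m≤n⇒m<n∨m≡n m<y)

  decode-arcs : ∀ n {a m w} → length w ≤ n → 1 ≤ a → a ≤ m → GrowsFrom m w → All (OnArcs a m) w → ¬ Crossing w →
    StartsWith a w → ∃ λ ts → arcs a m ts ≡ w
  decode-arcs n       _         _   _   _       _       _  []      = [] , refl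
  decode-arcs (suc n) {a} {m} (s≤s len) 1≤a a≤m (_ ∷ g) (_ ∷ on) nc at
    with split-at (All.map [ (λ { refl → ≤-refl }) , <⇒≤ ∘ ≤-<-trans a≤m ]′ on)
  ... | u , r , refl , a<u , start with GrowsFrom-++⁻ u (subst (λ k → GrowsFrom k (u ++ r)) (m≥n⇒m⊔n≡m a≤m) g)
  ...   | gu , gr = build (decode-word n (≤-trans (length-++-≤ˡ u) len) gu m<u (nc ∘ Crossing-⊆ (a ∷ʳ ++⁺ʳ r ⊆-refl)))
    where
    m<u : All (m <_) u
    m<u = All.zipWith (λ { (inj₁ refl , a<a) → contradiction a<a (<-irrefl refl) ; (inj₂ m<x , _) → m<x })
            (All.++⁻ˡ u on , a<u)

    -- A letter of r other than a that also occurs in u would close the crossing a c a c.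
    fresh : StartsWith a r → ∀ {c} → c ∈ r → m < c → peak m u < c
    fresh at {c} (here refl) m<c = contradiction (≤-<-trans a≤m m<c) (<-irrefl refl)
    fresh at {c} (there c∈) m<c with c ≤? peak m u
    ... | no  c≰ = ≰⇒> c≰
    ... | yes c≤ = contradiction (a , c , ≤-<-trans a≤m m<c ,
                     refl ∷ ++⁺ (Sublist.from∈ (GrowsFrom-covers gu m<c c≤)) (refl ∷ Sublist.from∈ c∈)) nc

    build : ∃ (λ t → word m t ≡ u) → ∃ λ ts → arcs a m ts ≡ a ∷ u ++ r
    build (t , refl) = let ts , e = decode-arcs n (≤-trans (length-++-≤ʳ r {word m t}) len) 1≤a (≤-trans a≤m (≤-peak m u)) gr
                                      (All.tabulate onArcs) (nc ∘ Crossing-⊆ (a ∷ʳ ++⁺ˡ u ⊆-refl)) start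
                       in t ∷ ts , cong (λ v → a ∷ u ++ v) e
      where
      onArcs : ∀ {x} → x ∈ r → OnArcs a (peak m u) x
      onArcs x∈ with All.lookup (All.++⁻ʳ u on) x∈
      ... | inj₁ x≡a = inj₁ x≡a
      ... | inj₂ m<x = inj₂ (fresh start x∈ m<x)

-- Word length as tree size

mutual
  size : Tree → ℕ
  size (node ts) = sum (sizes ts)

  sizes : List Tree → List ℕ
  sizes []       = []
  sizes (t ∷ ts) = suc (size t) ∷ sizes ts

-- `sizes` is spelled out to keep the recursion structural; as a `map` it is permuted along with the
-- subtrees, so reversal keeps the sum.
sizes≡map : ∀ ts → sizes ts ≡ map (suc ∘ size) ts
sizes≡map []       = refl
sizes≡map (t ∷ ts) = cong (_ ∷_) (sizes≡map ts)

mutual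
  length-word : ∀ m t → length (word m t) ≡ size t
  length-word m (node ts) = length-arcs (suc m) (suc m) ts

  length-arcs : ∀ a m ts → length (arcs a m ts) ≡ sum (sizes ts)
  length-arcs a m []       = refl
  length-arcs a m (t ∷ ts) = cong suc (trans (length-++ (word m t)) (cong₂ _+_ (length-word m t) (length-arcs a _ ts)))

-- The reversing involution

has? : ∀ p t → Dec (Has p t)
has? p t = ∃⊆? (λ u → orderIsomorphic? u p) (word 0 t)

All-reverse : ∀ {A : Set} {P : A → Set} {xs} → All P xs → All P (reverse xs)
All-reverse {xs = xs} = ↭.All-resp-↭ (↭-sym (↭-reverse xs))

AllPairs-reverse : ∀ {A : Set} {R : A → A → Set} {xs} → AllPairs R xs → AllPairs (flip R) (reverse xs)
AllPairs-reverse [] = []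
AllPairs-reverse {R = R} {x ∷ xs} (rx ∷ rxs) = subst (AllPairs (flip R)) (sym (unfold-reverse x xs))
  (AllPairs.++⁺ (AllPairs-reverse rxs) ([] ∷ []) (All.map (_∷ []) (All-reverse rx)))

module Swap (σ τ : Word) where

  mutual
    -- The test looks at the children before they are swapped. Swapping keeps containment of σ and
    -- of τ, so a second application meets the same answers.
    swap : Tree → Tree
    swap (node ts) = reversed (Any.any? (has? σ) ts ×-dec Any.any? (has? τ) ts) ts (swaps ts)

    swaps : List Tree → List Tree
    swaps []       = []
    swaps (t ∷ ts) = swap t ∷ swaps ts

    reversed : ∀ {A : Set} → Dec A → List Tree → List Tree → Tree
    reversed (yes _) ts us = node (reverse us)
    -- The subtrees stay untouched: a child containing either compound pattern would contain both σ
    -- and τ, and the test would have succeeded.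
    reversed (no  _) ts us = node ts

  Both : List Tree → Set
  Both ts = Any (Has σ) ts × Any (Has τ) ts

  both? : ∀ ts → Dec (Both ts)
  both? ts = Any.any? (has? σ) ts ×-dec Any.any? (has? τ) ts

  swaps≡map : ∀ ts → swaps ts ≡ map swap ts
  swaps≡map []       = refl
  swaps≡map (t ∷ ts) = cong (swap t ∷_) (swaps≡map ts)

  swap-both : ∀ {ts} → Both ts → swap (node ts) ≡ node (reverse (map swap ts))
  swap-both {ts} both with both? ts
  ... | yes _ = cong (node ∘ reverse) (swaps≡map ts)
  ... | no ∄  = contradiction both ∄

  swap-¬both : ∀ {ts} → ¬ Both ts → swap (node ts) ≡ node ts
  swap-¬both {ts} ∄ with both? ts
  ... | yes both = contradiction both ∄
  ... | no _     = refl

  Has-node : ∀ {p} ts → Any (Has p) ts → Has p (node ts)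
  Has-node {p} ts = Has-node⁺ {p} 1 1 ts

  Any-Both : ∀ {p} → p ∈ σ ∷ τ ∷ [] → ∀ {ts} → Both ts → Any (Has p) ts
  Any-Both (here refl)         = proj₁
  Any-Both (there (here refl)) = proj₂

  mutual
    -- An occurrence spread over several children need not survive reversal. But at a reversed node
    -- the test supplies one inside a single child, which survives by induction; this is special to
    -- σ and τ.
    swap-Has : ∀ {p} → p ∈ σ ∷ τ ∷ [] → ∀ t → Has p t → Has p (swap t)
    swap-Has {p} p∈ (node ts) h with both? ts
    ... | yes both = Has-node {p} (reverse (swaps ts)) (Any.reverse⁺ (swaps-Has p∈ ts (Any-Both p∈ both)))
    ... | no _     = h

    swaps-Has : ∀ {p} → p ∈ σ ∷ τ ∷ [] → ∀ ts → Any (Has p) ts → Any (Has p) (swaps ts)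
    swaps-Has {p} p∈ (t ∷ ts) (here h)  = here (swap-Has p∈ t h)
    swaps-Has {p} p∈ (t ∷ ts) (there h) = there (swaps-Has p∈ ts h)

  Both-reverse : ∀ ts → Both ts → Both (reverse (map swap ts))
  Both-reverse ts (s , t) = image (here refl) s , image (there (here refl)) t
    where
    image : ∀ {p} → p ∈ σ ∷ τ ∷ [] → Any (Has p) ts → Any (Has p) (reverse (map swap ts))
    image {p} p∈ h = Any.reverse⁺ (subst (Any (Has p)) (swaps≡map ts) (swaps-Has p∈ ts h))

  mutual
    swap-involutive : ∀ t → swap (swap t) ≡ t
    swap-involutive (node ts) = helper (both? ts)
      where
      helper : Dec (Both ts) → swap (swap (node ts)) ≡ node ts
      helper (no ∄)     = trans (cong swap (swap-¬both ∄)) (swap-¬both ∄)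
      helper (yes both) = begin
        swap (swap (node ts))                            ≡⟨ cong swap (swap-both both) ⟩
        -- The new children still contain σ and τ, so the node is reversed again.
        swap (node (reverse (map swap ts)))              ≡⟨ swap-both (Both-reverse ts both) ⟩
        node (reverse (map swap (reverse (map swap ts)))) ≡⟨ cong (node ∘ reverse) (reverse-map swap (map swap ts)) ⟩
        node (reverse (reverse (map swap (map swap ts)))) ≡⟨ cong node (reverse-involutive _) ⟩
        node (map swap (map swap ts))                    ≡⟨ cong node (map-∘ ts) ⟨
        node (map (swap ∘ swap) ts)                      ≡⟨ cong node (map-id-local (swaps-involutive ts)) ⟩
        node ts                                          ∎
        where open ≡-Reasoning

    swaps-involutive : ∀ ts → All (λ t → swap (swap t) ≡ t) ts
    swaps-involutive []       = []
    swaps-involutive (t ∷ ts) = swap-involutive t ∷ swaps-involutive ts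

  swap-Has⁻ : ∀ {p} → p ∈ σ ∷ τ ∷ [] → ∀ t → Has p (swap t) → Has p t
  swap-Has⁻ {p} p∈ t h = subst (Has p) (swap-involutive t) (swap-Has p∈ (swap t) h)

  mutual
    size-swap : ∀ t → size (swap t) ≡ size t
    size-swap (node ts) with both? ts
    ... | yes _ = trans (cong sum (sizes≡map (reverse (swaps ts))))
                    (trans (sum-↭ (↭.map⁺ (suc ∘ size) (↭-reverse (swaps ts))))
                      (cong sum (trans (sym (sizes≡map (swaps ts))) (sizes-swaps ts))))
    ... | no _  = refl

    sizes-swaps : ∀ ts → sizes (swaps ts) ≡ sizes ts
    sizes-swaps []       = refl
    sizes-swaps (t ∷ ts) = cong₂ (λ n ns → suc n ∷ ns) (size-swap t) (sizes-swaps ts)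

-- Transfer of avoidance and counting

module _ {σ τ : Word} (σ-part : IsPartition σ) (σ-conn : Connected σ)
         (τ-part : IsPartition τ) (τ-conn : Connected τ) where

  open Swap σ τ
  module σ-τ = Avoidance σ-part σ-conn τ-part τ-conn
  module τ-σ = Avoidance τ-part τ-conn σ-part σ-conn

  Ordered-¬both : ∀ ts → ¬ Both ts → AllPairs τ-σ.Ordered ts
  Ordered-¬both []       ∄ = []
  Ordered-¬both (t ∷ ts) ∄ = All.tabulate (λ { s∈ (hτ , hσ) → ∄ (there (Any.map (λ { refl → hσ }) s∈) , here hτ) })
    ∷ Ordered-¬both ts (λ { (s , t) → ∄ (there s , there t) })

  mutual
    -- At a reversed node the forbidden order of σ and τ among the children is reversed too. At an
    -- untouched node one of them is missing from all children, so no order can be violated.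
    swap-avoids : ∀ t → ¬ Has 1[ σ ]1[ τ ] t → ¬ Has 1[ τ ]1[ σ ] (swap t)
    swap-avoids (node ts) ∌P = helper (σ-τ.avoids⁻ ts ∌P) (both? ts)
      where
      helper : All (¬_ ∘ Has 1[ σ ]1[ τ ]) ts × AllPairs σ-τ.Ordered ts → Dec (Both ts) →
        ¬ Has 1[ τ ]1[ σ ] (swap (node ts))
      helper (∉ts , ords) (yes both) = subst (¬_ ∘ Has 1[ τ ]1[ σ ]) (sym (swap-both both))
        (τ-σ.avoids⁺ (reverse (map swap ts))
          (All-reverse (All.map⁺ (swaps-avoid ts ∉ts)))
          -- Containment in a swapped child is pulled back to the original child, where the old
          -- order condition applies.
          (AllPairs-reverse (AllPairs.map⁺ (AllPairs.map (λ {s} {t} ord (hτ , hσ) →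
            ord (swap-Has⁻ (here refl) s hσ , swap-Has⁻ (there (here refl)) t hτ)) ords))))
      helper (∉ts , _) (no ∄) = subst (¬_ ∘ Has 1[ τ ]1[ σ ]) (sym (swap-¬both ∄))
        (τ-σ.avoids⁺ ts
          -- In `τ-σ` the roles are exchanged: its `Has⇒Has-τ` yields σ and its `Has⇒Has-σ` yields
          -- τ.
          (All.tabulate λ {t} t∈ h → ∄ ( Any.map (λ { refl → τ-σ.Has⇒Has-τ t h }) t∈
                                       , Any.map (λ { refl → τ-σ.Has⇒Has-σ t h }) t∈))
          (Ordered-¬both ts ∄))

    swaps-avoid : ∀ ts → All (¬_ ∘ Has 1[ σ ]1[ τ ]) ts → All (¬_ ∘ Has 1[ τ ]1[ σ ] ∘ swap) ts
    swaps-avoid []       []         = []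
    swaps-avoid (t ∷ ts) (∉t ∷ ∉ts) = swap-avoids t ∉t ∷ swaps-avoid ts ∉ts

  -- Words are matched through their trees by `swap`, which is injective as an involution. One
  -- inequality suffices, since the hypotheses are symmetric in σ and τ.
  nc-≤ : ∀ n → nc n 1[ σ ]1[ τ ] ≤ nc n 1[ τ ]1[ σ ]
  nc-≤ n = injection⇒length≤ Swapped functional (Unique.filter⁺ (counted? 1[ σ ]1[ τ ]) (partitions-unique n)) _ image
    where
    counted? : ∀ p w → Dec (Avoids w ⟨1212⟩ × Avoids w p)
    counted? p w = avoids? w ⟨1212⟩ ×-dec avoids? w p

    Swapped : Word → Word → Set
    Swapped w v = ∃ λ t → w ≡ word 0 t × v ≡ word 0 (swap t)

    functional : ∀ {w w′ v} → Swapped w v → Swapped w′ v → w ≡ w′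
    functional (t , refl , refl) (t′ , refl , e) = cong (word 0)
      (trans (sym (swap-involutive t)) (trans (cong swap (word-injective 0 (swap t) (swap t′) e)) (swap-involutive t′)))

    image : ∀ {w} → w ∈ filter (counted? 1[ σ ]1[ τ ]) (partitions n) →
      ∃ λ v → v ∈ filter (counted? 1[ τ ]1[ σ ]) (partitions n) × Swapped w v
    image {w} w∈ with ∈-filter⁻ (counted? 1[ σ ]1[ τ ]) {xs = partitions n} w∈
    ... | w∈n , nc , ∌P with Equivalence.to (∈-partitions n w) w∈n
    ...   | g , len with decode-word (length w) ≤-refl g (GrowsFrom-positive g) (nc ∘ Crossing⇒Contains1212)
    ...     | t , refl = word 0 (swap t) , ∈-filter⁺ (counted? 1[ τ ]1[ σ ])
                (Equivalence.from (∈-partitions n _) (word-grows 0 (swap t) ,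
                  trans (trans (length-word 0 (swap t)) (size-swap t)) (trans (sym (length-word 0 t)) len)))
                (word-nc 0 (swap t) ∘ Contains1212⇒Crossing , swap-avoids t ∌P) , t , refl , refl

theorem3p7 : (σ τ : Word) →
    IsPartition σ → NonCrossing σ → Connected σ →
    IsPartition τ → NonCrossing τ → Connected τ →
    NCEquivalent 1[ σ ]1[ τ ] 1[ τ ]1[ σ ]
theorem3p7 σ τ σ-part _ σ-conn τ-part _ τ-conn n =
  ≤-antisym (nc-≤ σ-part σ-conn τ-part τ-conn n) (nc-≤ τ-part τ-conn σ-part σ-conn n)
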